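{- Let $D=\{2^i\mid i\in\mathbb{Z}_{\ge 0}\}$. For every positive integer $k$, \[ \Delta(D,k)\ge \left(\sqrt{\frac{8k-5}{12}}-\frac12\right)2^{\left(\sqrt{\frac{8k-5}{3}}-3\right)}. \]
   Context: For a set $D$ of positive integers, a $D$-diffsequence of length $k$ is a sequence of positive integers $a_1<\dots<a_k$ with $a_{i+1}-a_i\in D$ for all $i\in\{1,\dots,k-1\}$. A $2$-coloring of $\{1,\dots,n\}$ is a map $\chi:\{1,\dots,n\}\to\{0,1\}$; a diffsequence is monochromatic if $\chi$ is constant on its terms. $\Delta(D,k)$ denotes the smallest positive integer $n$ such that every $2$-coloring of $\{1,\dots,n\}$ contains a monochromatic $D$-diffsequence of length $k$. -}

module Defs where

open import Data.Nat using (ℕ; zero; suc; _+_; _*_; _∸_; _^_; _≤_; _<_)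
open import Data.Bool using (Bool)
open import Data.Product using (_×_; ∃-syntax; ∃₂)
open import Relation.Binary.PropositionalEquality using (_≡_)

InD : ℕ → Set
InD d = ∃[ e ] d ≡ 2 ^ e

IsDiffSeqIn : ℕ → ℕ → (ℕ → ℕ) → Set
IsDiffSeqIn n k a =
  (∀ i → i < k → 1 ≤ a i × a i ≤ n) ×
  (∀ i → suc i < k → a i < a (suc i) × InD (a (suc i) ∸ a i))

-- the 2-colouring χ (only its values on {1,…,n} matter) has a monochromatic
-- D-diffsequence of length k in {1,…,n}
HasMonoDiffSeq : ℕ → ℕ → (ℕ → Bool) → Set
HasMonoDiffSeq n k χ =
  ∃[ a ] (IsDiffSeqIn n k a × ∃[ c ] (∀ i → i < k → χ (a i) ≡ c))

-- every 2-colouring of {1,…,n} has a monochromatic D-diffsequence of length k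
-- (Δ(D,k) is the least n with this property)
ForcesMono : ℕ → ℕ → Set
ForcesMono k n = (χ : ℕ → Bool) → HasMonoDiffSeq n k χ

-- BelowBound k n  ⇔  n < (√((8k-5)/12) - 1/2) · 2^(√((8k-5)/3) - 3)   (real inequality)
-- Encoding: with s = √((8k-5)/12), the bound is f(s) = (s - 1/2)·2^(2s-3), f continuous and
-- increasing on s > 1/2, so n < f(s) iff there is a rational q = a/b with 1/2 < q < s and
-- n < f(q); the latter, raised to the b-th power and cleared of denominators, reads
-- (2bn)^b · 2^(3b) < (2a-b)^b · 2^(2a).
BelowBound : ℕ → ℕ → Set
BelowBound k n = ∃₂ λ a b →
  0 < b × 12 * (a * a) < (8 * k ∸ 5) * (b * b) × b < 2 * a ×
  (2 * b * n) ^ b * 2 ^ (3 * b) < (2 * a ∸ b) ^ b * 2 ^ (2 * a)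

{-# OPTIONS --safe #-}
module Submission where

open import Defs
open import Data.Bool using (Bool; true; false; not; _xor_)
open import Data.Bool.Properties using (not-¬; not-injective; not-involutive)
open import Data.Empty using (⊥)
open import Data.Fin using (Fin; toℕ; zero; suc)
open import Data.Fin.Properties using (toℕ<n; toℕ-injective; toℕ-fromℕ<)
open import Data.Nat using (ℕ; zero; suc; _+_; _*_; _∸_; _^_; _≤_; _<_; z≤n; s≤s; _≤?_;
  NonZero; >-nonZero)
open import Data.Nat.DivMod
open import Data.Nat.Properties
open import Data.Nat.Tactic.RingSolver using (solve-∀)
open import Data.Product using (_×_; _,_; proj₁; proj₂; ∃-syntax)
open import Relation.Binary.PropositionalEquality
open import Relation.Nullary using (¬_; yes; no; contradiction)

-- Numbers are read in base 4 with u digits below an unrestricted leading digit and coloured by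
-- the parity of the digit sum.  The potential below strictly increases along every monochromatic
-- step of size 2^e, so a monochromatic diffsequence is no longer than the range of the potential,
-- which is T + 3u(u+1)/2 on {0,…,T·4^u − 1}.  Taking r = ⌊√((8k−5)/3)⌋, the bound is less than
-- r·2^(r−3), and for r ≥ 2 the parity of r decides between T = r/2 and T = r in T·4^u = r·2^(r−3).

-- Base-4 digits, the colouring and the potential.

toℕ-mod : ∀ n (d : Fin (suc n)) q → (toℕ d + q * suc n) mod suc n ≡ d
toℕ-mod n d q = toℕ-injective (begin
  toℕ ((toℕ d + q * suc n) mod suc n) ≡⟨ toℕ-fromℕ< _ ⟩
  (toℕ d + q * suc n) % suc n         ≡⟨ [m+kn]%n≡m%n (toℕ d) q (suc n) ⟩
  toℕ d % suc n                       ≡⟨ m<n⇒m%n≡m (toℕ<n d) ⟩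
  toℕ d                               ∎)
  where open ≡-Reasoning

toℕ-div : ∀ n (d : Fin (suc n)) q → (toℕ d + q * suc n) / suc n ≡ q
toℕ-div n d q = *-cancelʳ-≡ _ q (suc n) (+-cancelˡ-≡ (toℕ d) _ _ (begin
  toℕ d + x / suc n * suc n                ≡⟨ cong (λ e → toℕ e + x / suc n * suc n) (toℕ-mod n d q) ⟨
  toℕ (x mod suc n) + x / suc n * suc n    ≡⟨ cong (_+ x / suc n * suc n) (toℕ-fromℕ< _) ⟩
  x % suc n + x / suc n * suc n            ≡⟨ m≡m%n+[m/n]*n x (suc n) ⟨
  x                                        ∎))
  where open ≡-Reasoning
        x = toℕ d + q * suc n

isOdd : ℕ → Bool
isOdd zero    = false
isOdd (suc n) = not (isOdd n)

colour : ℕ → ℕ → Bool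
colour zero    x = isOdd x
colour (suc u) x = isOdd (toℕ (x mod 4)) xor colour u (x / 4)

pattern 0d = zero
pattern 1d = suc zero
pattern 2d = suc (suc zero)
pattern 3d = suc (suc (suc zero))

-- Steps of 2 inside a digit keep the colour, so weight must rise along 0 → 2 and 1 → 3;
-- the large gap between {1,3} and {0,2} pays for the drop that a carry causes higher up.
weight : ℕ → Fin 4 → ℕ
weight u 0d = 2 + 3 * u
weight u 1d = 0
weight u 2d = 3 + 3 * u
weight u 3d = 1

potential : ℕ → ℕ → ℕ
potential zero    x = x
potential (suc u) x = weight u (x mod 4) + potential u (x / 4)

colour-digit : ∀ u d q → colour (suc u) (toℕ d + q * 4) ≡ isOdd (toℕ d) xor colour u q
colour-digit u d q = cong₂ (λ e p → isOdd (toℕ e) xor colour u p) (toℕ-mod 3 d q) (toℕ-div 3 d q)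

potential-digit : ∀ u d q → potential (suc u) (toℕ d + q * 4) ≡ weight u d + potential u q
potential-digit u d q = cong₂ (λ e p → weight u e + potential u p) (toℕ-mod 3 d q) (toℕ-div 3 d q)

-- `f` is the identity where a step keeps the colour and `not` where it flips it, so one lemma
-- serves both situations.
colour-step : ∀ u d q d′ q′ {f : Bool → Bool} →
  colour (suc u) (toℕ d′ + q′ * 4) ≡ f (colour (suc u) (toℕ d + q * 4)) →
  isOdd (toℕ d′) xor colour u q′ ≡ f (isOdd (toℕ d) xor colour u q)
colour-step u d q d′ q′ {f} eq =
  trans (sym (colour-digit u d′ q′)) (trans eq (cong f (colour-digit u d q)))

-- The offsets `i` and `j` cover both a guaranteed gain (`j` = 0) and a bounded loss.
potential-step : ∀ u d q d′ q′ {i j} →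
  i + (weight u d + potential u q) ≤ j + (weight u d′ + potential u q′) →
  i + potential (suc u) (toℕ d + q * 4) ≤ j + potential (suc u) (toℕ d′ + q′ * 4)
potential-step u d q d′ q′ {i} {j} =
  subst₂ _≤_ (cong (i +_) (sym (potential-digit u d q))) (cong (j +_) (sym (potential-digit u d′ q′)))

-- Change of the potential along steps of size 2^e.

mutual
  -- Only a carry can keep the colour. The digit change 3 → 0 then gains 1 + 3u, while the higher
  -- digits, whose colour flips, lose at most 3u - 1. The surplus of 2, rather than 1, is spent on
  -- carries in steps of size 2.
  suc-mono : ∀ u x → colour u (suc x) ≡ colour u x → 2 + potential u x ≤ potential u (suc x)
  suc-mono zero    x eq = contradiction (sym eq) (not-¬ refl)
  suc-mono (suc u) x eq with x divMod 4
  ... | result q 0d refl = contradiction (sym (colour-step u 0d q 1d q {λ c → c} eq)) (not-¬ refl)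
  ... | result q 1d refl = contradiction (colour-step u 1d q 2d q {λ c → c} eq) (not-¬ refl)
  ... | result q 2d refl = contradiction (sym (colour-step u 2d q 3d q {λ c → c} eq)) (not-¬ refl)
  ... | result q 3d refl = potential-step u 3d q 0d (suc q) {2} {0}
    (s≤s (s≤s (suc-flip u q (colour-step u 3d q 0d (suc q) {λ c → c} eq))))

  -- The worst cases are 0 → 1 and 2 → 3, each losing exactly 2 + 3u. A carry flips the parity of
  -- the lowest digit, so the higher digits keep their colour and `suc-mono` applies to them.
  suc-flip : ∀ u x → colour u (suc x) ≡ not (colour u x) → 1 + potential u x ≤ 3 * u + potential u (suc x)
  suc-flip zero    x eq = ≤-refl
  suc-flip (suc u) x eq with x divMod 4
  ... | result q 0d refl = potential-step u 0d q 1d q {1} {3 * suc u}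
    (≤-reflexive (cong (_+ potential u q) (sym (*-suc 3 u))))
  ... | result q 1d refl = potential-step u 1d q 2d q {1} {3 * suc u}
    (≤-trans (s≤s (m≤n+m _ (2 + 3 * u))) (m≤n+m _ (3 * suc u)))
  ... | result q 2d refl = potential-step u 2d q 3d q {1} {3 * suc u}
    (≤-reflexive (trans (cong (λ s → suc (s + potential u q)) (sym (*-suc 3 u)))
      (sym (+-suc (3 * suc u) (potential u q)))))
  ... | result q 3d refl = potential-step u 3d q 0d (suc q) {1} {3 * suc u}
    (≤-trans (suc-mono u q (trans (colour-step u 3d q 0d (suc q) {not} eq) (not-involutive _)))
      (≤-trans (m≤n+m _ (2 + 3 * u)) (m≤n+m _ (3 * suc u))))

2^[2+e]-step : ∀ e d q → 2 ^ (2 + e) + (d + q * 4) ≡ d + (2 ^ e + q) * 4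
2^[2+e]-step e d q = lemma (2 ^ e) d q
  where
  lemma : ∀ p d q → 2 * (2 * p) + (d + q * 4) ≡ d + (p + q) * 4
  lemma = solve-∀

xor-cancelˡ : ∀ b {c d} → b xor c ≡ b xor d → c ≡ d
xor-cancelˡ false eq = eq
xor-cancelˡ true  eq = not-injective eq

2^-mono : ∀ u e x → colour u (2 ^ e + x) ≡ colour u x → potential u x < potential u (2 ^ e + x)
2^-mono u zero x eq = <⇒≤ (suc-mono u x eq)
2^-mono zero e@(suc _) x eq = +-monoˡ-≤ x (m^n>0 2 e)
2^-mono (suc u) (suc zero) x eq with x divMod 4
... | result q 0d refl = potential-step u 0d q 2d q {1} {0} ≤-refl
... | result q 1d refl = potential-step u 1d q 3d q {1} {0} ≤-refl
-- A carry from 2 or 3 lowers the weight by 1 but preserves the digit's parity, so the higher digits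
-- keep their colour and gain at least 2.
... | result q 2d refl = potential-step u 2d q 0d (suc q) {1} {0}
  (subst (_≤ 2 + 3 * u + potential u (suc q)) (shift (3 * u) (potential u q))
    (+-monoʳ-≤ (2 + 3 * u) (suc-mono u q (colour-step u 2d q 0d (suc q) {λ c → c} eq))))
  where
  shift : ∀ m n → 2 + m + (2 + n) ≡ 1 + (3 + m + n)
  shift = solve-∀
... | result q 3d refl = potential-step u 3d q 1d (suc q) {1} {0}
  (suc-mono u q (not-injective (colour-step u 3d q 1d (suc q) {λ c → c} eq)))
-- A multiple of 4 leaves the lowest digit alone and acts as a step of size 2^e on the quotient.
2^-mono (suc u) (suc (suc e)) x eq with x divMod 4
... | result q d refl rewrite 2^[2+e]-step e (toℕ d) q = potential-step u d q d (2 ^ e + q) {1} {0}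
  (subst (_≤ weight u d + potential u (2 ^ e + q)) (+-suc (weight u d) (potential u q))
    (+-monoʳ-≤ (weight u d)
      (2^-mono u e q (xor-cancelˡ (isOdd (toℕ d)) (colour-step u d q d (2 ^ e + q) {λ c → c} eq)))))

-- Range of the potential and length of monochromatic diffsequences.

capacity : ℕ → ℕ
capacity zero    = 0
capacity (suc u) = 3 * suc u + capacity u

2*capacity : ∀ u → 2 * capacity u ≡ 3 * (u * suc u)
2*capacity zero    = refl
2*capacity (suc u) = begin
  2 * (3 * suc u + capacity u)     ≡⟨ *-distribˡ-+ 2 (3 * suc u) (capacity u) ⟩
  2 * (3 * suc u) + 2 * capacity u ≡⟨ cong (2 * (3 * suc u) +_) (2*capacity u) ⟩
  2 * (3 * suc u) + 3 * (u * suc u) ≡⟨ lemma u ⟩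
  3 * (suc u * suc (suc u))        ∎
  where
  open ≡-Reasoning
  lemma : ∀ u → 2 * (3 * (1 + u)) + 3 * (u * (1 + u)) ≡ 3 * ((1 + u) * (2 + u))
  lemma = solve-∀

weight≤ : ∀ u d → weight u d ≤ 3 * suc u
weight≤ u d rewrite *-suc 3 u with d
... | 0d = n≤1+n _
... | 1d = z≤n
... | 2d = ≤-refl
... | 3d = s≤s z≤n

-- Each restricted digit contributes at most its largest weight, and these maxima add up to 3(1 +
-- ... + u); the leading digit is below T.
potential< : ∀ u T x → x < T * 4 ^ u → potential u x < T + capacity u
potential< zero T x x< = subst₂ _≤_ refl (trans (*-identityʳ T) (sym (+-identityʳ T))) x<
potential< (suc u) T x x< = begin
  suc (weight u (x mod 4) + potential u (x / 4)) ≡⟨ +-suc (weight u (x mod 4)) _ ⟨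
  weight u (x mod 4) + suc (potential u (x / 4)) ≤⟨ +-mono-≤ (weight≤ u (x mod 4)) (potential< u T (x / 4) x/4<) ⟩
  3 * suc u + (T + capacity u)                   ≡⟨ lemma (3 * suc u) T (capacity u) ⟩
  T + (3 * suc u + capacity u)                   ∎
  where
  open ≤-Reasoning
  lemma : ∀ a b c → a + (b + c) ≡ b + (a + c)
  lemma = solve-∀
  x/4< : x / 4 < T * 4 ^ u
  x/4< = m<n*o⇒m/o<n (subst (x <_) (trans (cong (T *_) (*-comm 4 (4 ^ u))) (sym (*-assoc T (4 ^ u) 4))) x<)

strictly-increasing-≤ : ∀ k (f : ℕ → ℕ) → (∀ i → suc i < k → f i < f (suc i)) → ∀ i → i < k → i ≤ f i
strictly-increasing-≤ k f f< zero    i<k = z≤n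
strictly-increasing-≤ k f f< (suc i) i<k =
  ≤-trans (s≤s (strictly-increasing-≤ k f f< i (<⇒≤ i<k))) (f< i i<k)

-- Along the sequence the potentials are strictly increasing naturals, so the last one is at least k
-- - 1.
mono-length : ∀ u T n k → n < T * 4 ^ u → HasMonoDiffSeq n k (colour u) → k ≤ T + capacity u
mono-length u T n zero    n< _ = z≤n
mono-length u T n (suc k) n< (a , (range , step) , c , mono) = begin-strict
  k                    ≤⟨ strictly-increasing-≤ (suc k) (λ i → potential u (a i)) increasing k ≤-refl ⟩
  potential u (a k)    <⟨ potential< u T (a k) (≤-<-trans (proj₂ (range k ≤-refl)) n<) ⟩
  T + capacity u       ∎
  where
  open ≤-Reasoning
  increasing : ∀ i → suc i < suc k → potential u (a i) < potential u (a (suc i))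
  increasing i i< with step i i<
  ... | a< , e , eq = subst (λ x → potential u (a i) < potential u x) next
    (2^-mono u e (a i) (trans (cong (colour u) next) (trans (mono (suc i) i<) (sym (mono i (<⇒≤ i<))))))
    where
    next : 2 ^ e + a i ≡ a (suc i)
    next = trans (cong (_+ a i) (sym eq)) (m∸n+n≡m (<⇒≤ a<))

-- From the real bound to integers.

root-bounds : ∀ K → ∃[ r ] (3 * (r * r) ≤ K × K < 3 * (suc r * suc r))
root-bounds zero = 0 , z≤n , s≤s z≤n
root-bounds (suc K) with root-bounds K
... | r , lo , hi with 3 * (suc r * suc r) ≤? suc K
...   | yes le = suc r , le , ≤-<-trans hi (*-monoʳ-< 3 (*-mono-< (n<1+n (suc r)) (n<1+n (suc r))))
...   | no  ≰  = r , m≤n⇒m≤1+n lo , ≰⇒> ≰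

square-cancel-< : ∀ {m n} → m * m < n * n → m < n
square-cancel-< lt = ≰⇒> λ n≤m → <⇒≱ lt (*-mono-≤ n≤m n≤m)

^-cancelˡ-< : ∀ {m n} b → m ^ b < n ^ b → m < n
^-cancelˡ-< b lt = ≰⇒> λ n≤m → <⇒≱ lt (^-monoˡ-≤ b n≤m)

^-distrib-* : ∀ m n b → (m * n) ^ b ≡ m ^ b * n ^ b
^-distrib-* m n zero    = refl
^-distrib-* m n (suc b) = trans (cong (m * n *_) (^-distrib-* m n b)) (lemma m n (m ^ b) (n ^ b))
  where
  lemma : ∀ m n p q → m * n * (p * q) ≡ m * p * (n * q)
  lemma = solve-∀

-- For the rational q = a/b of the encoding, 2q < r + 1. Hence q - 1/2 < r/2 and 2^(2q-3) < 2^(r-2),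
-- with product r·2^(r-3). The comparison is made between b-th powers, and the root is taken at the
-- end.
BelowBound⇒< : ∀ k n r → 8 * k ∸ 5 < 3 * (suc r * suc r) → BelowBound k n → 8 * n < r * 2 ^ r
BelowBound⇒< k n r hi (a , b , b>0 , a<s , _ , below) =
  *-cancelˡ-< (2 * b) _ _ (subst₂ _<_ (lhs b n) (rhs r b (2 ^ r)) (^-cancelˡ-< b (begin-strict
    (2 * b * n * 2 ^ 3) ^ b          ≡⟨ ^-distrib-* (2 * b * n) (2 ^ 3) b ⟩
    (2 * b * n) ^ b * (2 ^ 3) ^ b    ≡⟨ cong ((2 * b * n) ^ b *_) (^-*-assoc 2 3 b) ⟩
    (2 * b * n) ^ b * 2 ^ (3 * b)    <⟨ below ⟩
    (2 * a ∸ b) ^ b * 2 ^ (2 * a)    ≤⟨ *-mono-≤ (^-monoˡ-≤ b (m≤n+o⇒m∸n≤o (2 * a) b (<⇒≤ 2a<))) (^-monoʳ-≤ 2 (<⇒≤ 2a<)) ⟩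
    (r * b) ^ b * 2 ^ (suc r * b)    ≡⟨ cong ((r * b) ^ b *_) (^-*-assoc 2 (suc r) b) ⟨
    (r * b) ^ b * (2 ^ suc r) ^ b    ≡⟨ ^-distrib-* (r * b) (2 ^ suc r) b ⟨
    (r * b * 2 ^ suc r) ^ b          ∎)))
  where
  open ≤-Reasoning
  instance
    b≢0 : NonZero b
    b≢0 = >-nonZero b>0
  2a< : 2 * a < suc r * b
  2a< = square-cancel-< (*-cancelˡ-< 3 _ _ (begin-strict
    3 * (2 * a * (2 * a))             ≡⟨ sq a ⟩
    12 * (a * a)                      <⟨ a<s ⟩
    (8 * k ∸ 5) * (b * b)             ≤⟨ *-monoˡ-≤ (b * b) (<⇒≤ hi) ⟩
    3 * (suc r * suc r) * (b * b)     ≡⟨ sq′ (suc r) b ⟩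
    3 * (suc r * b * (suc r * b))     ∎))
    where
    sq : ∀ a → 3 * (2 * a * (2 * a)) ≡ 12 * (a * a)
    sq = solve-∀
    sq′ : ∀ r b → 3 * (r * r) * (b * b) ≡ 3 * (r * b * (r * b))
    sq′ = solve-∀
  lhs : ∀ b n → 2 * b * n * 8 ≡ 2 * b * (8 * n)
  lhs = solve-∀
  rhs : ∀ r b p → r * b * (2 * p) ≡ 2 * b * (r * p)
  rhs = solve-∀

data Parity : ℕ → Set where
  even : ∀ m → Parity (2 * m)
  odd  : ∀ m → Parity (1 + 2 * m)

parity : ∀ n → Parity n
parity zero = even 0
parity (suc n) with parity n
... | even m = odd m
... | odd m  = subst Parity (*-suc 2 m) (even (suc m))

-- Multiplying by 8 clears denominators: 8(T + 3u(u+1)/2) = 8T + 12u(u+1), which is less than 3r²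
-- and so less than 8k.
exceeds-capacity : ∀ u T k r → 8 * T + 12 * (u * suc u) < 3 * (r * r) → 3 * (r * r) ≤ 8 * k ∸ 5 →
  ¬ k ≤ T + capacity u
exceeds-capacity u T k r lt lo k≤ = <⇒≱ lt (begin
  3 * (r * r)                   ≤⟨ lo ⟩
  8 * k ∸ 5                     ≤⟨ m∸n≤m (8 * k) 5 ⟩
  8 * k                         ≤⟨ *-monoʳ-≤ 8 k≤ ⟩
  8 * (T + capacity u)          ≡⟨ split T (capacity u) ⟩
  8 * T + 4 * (2 * capacity u)  ≡⟨ cong (λ c → 8 * T + 4 * c) (2*capacity u) ⟩
  8 * T + 4 * (3 * (u * suc u)) ≡⟨ cong (8 * T +_) (*-assoc 4 3 (u * suc u)) ⟨
  8 * T + 12 * (u * suc u)      ∎)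
  where
  open ≤-Reasoning
  split : ∀ T c → 8 * (T + c) ≡ 8 * T + 4 * (2 * c)
  split = solve-∀

theorem1 : (k : ℕ) → 1 ≤ k → (n : ℕ) → ForcesMono k n → ¬ BelowBound k n
theorem1 k 1≤k n forces below with root-bounds (8 * k ∸ 5)
... | r , lo , hi = by-parity r (parity r) lo (BelowBound⇒< k n r hi below)
  where
  short : ∀ u T r → 8 * T + 12 * (u * suc u) < 3 * (r * r) → 3 * (r * r) ≤ 8 * k ∸ 5 →
          8 * n < 8 * (T * 4 ^ u) → ⊥
  short u T r lt lo n< = exceeds-capacity u T k r lt lo
    (mono-length u T n k (*-cancelˡ-< 8 _ _ n<) (forces (colour u)))

  4^ : ∀ c u → c * 2 ^ (2 * u) ≡ c * 4 ^ u
  4^ c u = cong (c *_) (sym (^-*-assoc 2 2 u))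

  by-parity : ∀ r → Parity r → 3 * (r * r) ≤ 8 * k ∸ 5 → 8 * n < r * 2 ^ r → ⊥
  by-parity .0 (even zero) lo ()
  -- Here 8n < 2 forces n = 0, yet a nonempty diffsequence needs n ≥ 1.
  by-parity .1 (odd zero) lo n< with forces (λ _ → true)
  ... | _ , (range , _) , _ =
    <⇒≱ n< (≤-trans (s≤s (s≤s z≤n)) (*-monoʳ-≤ 8 (≤-trans (proj₁ (range 0 1≤k)) (proj₂ (range 0 1≤k)))))
  -- For r = 2(m+1): u = m and T = m + 1 give T·4^u = r·2^(r-3).
  by-parity .(2 * suc m) (even (suc m)) lo n< = short m (suc m) (2 * suc m) (sizes m) lo
    (subst (8 * n <_) (trans (cong (λ r → 2 * suc m * 2 ^ r) (*-suc 2 m))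
      (trans (value m (2 ^ (2 * m))) (cong (8 *_) (4^ (suc m) m)))) n<)
    where
    sizes : ∀ m → 8 * suc m + 12 * (m * suc m) < 3 * (2 * suc m * (2 * suc m))
    -- 4m + 3 is the exact slack in the strict inequality.
    sizes m = ≤-trans (m≤m+n _ (4 * m + 3)) (≤-reflexive (lemma m))
      where
      lemma : ∀ m → 1 + (8 * (1 + m) + 12 * (m * (1 + m))) + (4 * m + 3) ≡ 3 * (2 * (1 + m) * (2 * (1 + m)))
      lemma = solve-∀
    value : ∀ m p → 2 * (1 + m) * (2 * (2 * p)) ≡ 8 * ((1 + m) * p)
    value = solve-∀
  -- For r = 2m + 3 the factor 2^(r-3) is already 4^m, so u = m and T = r.
  by-parity .(1 + 2 * suc m) (odd (suc m)) lo n< = short m (3 + 2 * m) (1 + 2 * suc m) (sizes m) lo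
    (subst (8 * n <_) (trans (cong (λ r → suc r * 2 ^ suc r) (*-suc 2 m))
      (trans (value (3 + 2 * m) (2 ^ (2 * m))) (cong (8 *_) (4^ (3 + 2 * m) m)))) n<)
    where
    sizes : ∀ m → 8 * (3 + 2 * m) + 12 * (m * suc m) < 3 * ((1 + 2 * suc m) * (1 + 2 * suc m))
    sizes m = ≤-trans (m≤m+n _ (8 * m + 2)) (≤-reflexive (lemma m))
      where
      lemma : ∀ m → 1 + (8 * (3 + 2 * m) + 12 * (m * (1 + m))) + (8 * m + 2) ≡ 3 * ((1 + 2 * (1 + m)) * (1 + 2 * (1 + m)))
      lemma = solve-∀
    value : ∀ c p → c * (2 * (2 * (2 * p))) ≡ 8 * (c * p)
    value = solve-∀
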